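{- Let $x$ and $t$ be positive integers with $x \equiv 2$ or $4 \pmod 6$. Then there exists a solution to $\mathrm{HWP}(6xt;6,2x;1,3xt-2)$.
   Context: For integers $M,N \geq 3$ and even $v$, a solution to $\mathrm{HWP}(v;M,N;\alpha,\beta)$ is a decomposition of the edge set of $K_v - F$, for some 1-factor (perfect matching) $F$ of $K_v$, into $\alpha$ $C_M$-factors and $\beta$ $C_N$-factors, where a $C_M$-factor is a spanning subgraph all of whose connected components are cycles of length $M$. -}

module Defs where

open import Data.Nat using (ℕ; suc; _<_; _≤_)
open import Data.Fin using (Fin; toℕ)
open import Data.Product using (Σ; ∃; _×_; _,_; proj₁; proj₂)
open import Data.Sum using (_⊎_)
open import Relation.Binary.PropositionalEquality using (_≡_; _≢_)
open import Relation.Nullary using (¬_)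
open import Function.Bundles using (_↔_; Inverse)

Graph : ℕ → Set₁
Graph v = Fin v → Fin v → Set

record OneFactor (v : ℕ) : Set where
  field
    mate     : Fin v → Fin v
    involut  : ∀ x → mate (mate x) ≡ x
    nofix    : ∀ x → mate x ≢ x

Succ : (M : ℕ) → Fin M → Fin M → Set
Succ M a b = (toℕ b ≡ suc (toℕ a)) ⊎ (suc (toℕ a) ≡ M × toℕ b ≡ 0)

CycAdj : (M : ℕ) → Fin M → Fin M → Set
CycAdj M a b = Succ M a b ⊎ Succ M b a

-- G is a C_M-factor of the vertex set Fin v: the vertices split into k
-- cycles of length M each (a bijection Fin v ↔ Fin k × Fin M assigns each
-- vertex its cycle and its position on that cycle), and G is exactly the
-- union of these cycles: x ~ y iff same cycle and consecutive positions.
record IsCycleFactor (M : ℕ) {v : ℕ} (G : Graph v) : Set where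
  field
    k      : ℕ
    label  : Fin v ↔ (Fin k × Fin M)
  cyc : Fin v → Fin k
  cyc x = proj₁ (Inverse.to label x)
  pos : Fin v → Fin M
  pos x = proj₂ (Inverse.to label x)
  field
    adj    : ∀ x y → (G x y → (cyc x ≡ cyc y × CycAdj M (pos x) (pos y)))
                   × ((cyc x ≡ cyc y × CycAdj M (pos x) (pos y)) → G x y)

record HWP (v M N α β : ℕ) : Set₁ where
  field
    F        : OneFactor v
    factor   : Fin (α Data.Nat.+ β) → Graph v
    isM      : ∀ i → toℕ i < α → IsCycleFactor M (factor i)
    isN      : ∀ i → α ≤ toℕ i → IsCycleFactor N (factor i)
    avoidF   : ∀ i x y → factor i x y → y ≢ OneFactor.mate F x
    cover    : ∀ x y → x ≢ y → y ≢ OneFactor.mate F x → ∃ λ i → factor i x y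
    unique   : ∀ i j x y → factor i x y → factor j x y → i ≡ j

{-# OPTIONS --safe #-}
module Submission where

-- Here x is even.  Replace each vertex of K_{6t} by x points.  Take a
-- 1-factorisation of K_{6t} in which two 1-factors L₀, L₁ form a C_6-factor.
--   * L₀ together with the edges inside the blown-up vertices is a union of copies of K_{2x},
--     each splitting into a 1-factor J₀ and x − 1 Hamiltonian cycles.
--   * Any other 1-factor gives copies of K_{x,x}, and the edges with coordinate sum c or c + 1
--     form a Hamiltonian cycle of it.
--   * For L₁, the sum 0 instead completes J₀ to the C_6-factor and the sum 1 is the removed
--     1-factor, leaving the sums 2, …, x − 1 to be paired as before.
-- K_{6t} itself arises in the same way by blowing up K_{2t} threefold: L₀ and L₁ are then
-- consecutive 1-factors of the copies of K_6.  In the round-robin 1-factorisation of K_{2m}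
-- on ℤ/(2m−1) ∪ {∞} any two consecutive 1-factors form a Hamiltonian cycle, which supplies
-- both the splitting of K_{2x} and the hexagons.

open import Defs
open import Algebra.Bundles using (AbelianGroup)
open import Algebra.Structures using (IsAbelianGroup)
import Algebra.Properties.AbelianGroup as AbelianGroupProperties
import Algebra.Properties.CommutativeSemigroup as CommutativeSemigroupProperties
open import Data.Empty using (⊥-elim)
open import Data.Fin using (Fin; zero; suc; toℕ; fromℕ; inject₁; opposite; combine; quotient; remainder; splitAt; cast; _↑ˡ_; _↑ʳ_)
open import Data.Fin.Patterns using (0F; 1F)
open import Data.Fin.Properties using (_≟_; toℕ-injective; toℕ<n; toℕ-fromℕ; toℕ-fromℕ<; toℕ-inject₁; toℕ-↑ˡ; toℕ-↑ʳ; toℕ-cast; toℕ-combine; opposite-prop; opposite-involutive; splitAt-↑ˡ; splitAt-↑ʳ; splitAt⁻¹-↑ˡ; splitAt⁻¹-↑ʳ; combine-remQuot; remQuot-combine; cast-is-id; cast-trans; +↔⊎; *↔×)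
open import Data.Maybe using (Maybe; just; nothing)
import Data.Maybe as Maybe
open import Data.Maybe.Properties using (just-injective)
open import Data.Nat using (ℕ; zero; suc; pred; _+_; _*_; _∸_; _%_; _≤_; s≤s)
open import Data.Nat.DivMod using (_mod_; _/_; m%n<n; m%n%n≡m%n; m<n⇒m%n≡m; %-distribˡ-+; %-distribˡ-*; [m+kn]%n≡m%n; m≡m%n+[m/n]*n)
open import Data.Nat.Properties using (+-assoc; +-comm; +-suc; +-identityʳ; *-comm; *-distribʳ-+; *-cancelˡ-≡; *-cancelʳ-≡; +-cancelʳ-≡; m∸n+n≡m; m+[n∸m]≡n; <⇒≤; suc-injective; even≢odd)
open import Data.Nat.Solver using (module +-*-Solver)
open import Data.Product using (∃; _×_; _,_; proj₁; proj₂)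
open import Data.Product.Algebra using (×-assoc; ×-cong)
open import Data.Sum using (_⊎_; inj₁; inj₂)
open import Data.Sum.Function.Propositional using (_⊎-cong_)
open import Data.Sum.Properties using (inj₁-injective)
open import Function using (_∘_)
open import Function.Bundles using (_↔_; Inverse; mk↔ₛ′)
open import Function.Properties.Inverse using (↔-refl; ↔-sym; ↔-trans)
open import Level using (0ℓ)
open import Relation.Binary.PropositionalEquality using (_≡_; _≢_; refl; sym; trans; cong; cong₂; subst; subst₂; isEquivalence; module ≡-Reasoning)
open import Relation.Nullary using (yes; no; contradiction)

open Inverse using (to; from; strictlyInverseˡ; strictlyInverseʳ)

to-injective : ∀ {A B : Set} (f : A ↔ B) {x y} → to f x ≡ to f y → x ≡ y
to-injective f {x} {y} eq =
  trans (sym (strictlyInverseʳ f x)) (trans (cong (from f) eq) (strictlyInverseʳ f y))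

-- Addition modulo n on `Fin n`

module Cyclic (k : ℕ) where

  n : ℕ
  n = suc k

  ⟦_⟧ : ℕ → Fin n
  ⟦ i ⟧ = i mod n

  infixl 6 _⊕_
  infix 8 ⊖_

  _⊕_ : Fin n → Fin n → Fin n
  a ⊕ b = ⟦ toℕ a + toℕ b ⟧

  ⊖_ : Fin n → Fin n
  ⊖ a = ⟦ n ∸ toℕ a ⟧

  toℕ-⟦⟧ : ∀ i → toℕ ⟦ i ⟧ ≡ i % n
  toℕ-⟦⟧ i = toℕ-fromℕ< (m%n<n i n)

  ⟦⟧-≡ : ∀ i j → i % n ≡ j % n → ⟦ i ⟧ ≡ ⟦ j ⟧
  ⟦⟧-≡ i j eq = toℕ-injective (trans (toℕ-⟦⟧ i) (trans eq (sym (toℕ-⟦⟧ j))))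

  ⟦toℕ⟧ : ∀ a → ⟦ toℕ a ⟧ ≡ a
  ⟦toℕ⟧ a = toℕ-injective (trans (toℕ-⟦⟧ (toℕ a)) (m<n⇒m%n≡m (toℕ<n a)))

  ⟦⟧-⊕ : ∀ i j → ⟦ i ⟧ ⊕ ⟦ j ⟧ ≡ ⟦ i + j ⟧
  ⟦⟧-⊕ i j = ⟦⟧-≡ (toℕ ⟦ i ⟧ + toℕ ⟦ j ⟧) (i + j)
    (trans (cong₂ (λ a b → (a + b) % n) (toℕ-⟦⟧ i) (toℕ-⟦⟧ j)) (sym (%-distribˡ-+ i j n)))

  ⟦+kn⟧ : ∀ i j → ⟦ i + j * n ⟧ ≡ ⟦ i ⟧
  ⟦+kn⟧ i j = ⟦⟧-≡ (i + j * n) i ([m+kn]%n≡m%n i j n)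

  ⟦+n⟧ : ∀ i → ⟦ i + n ⟧ ≡ ⟦ i ⟧
  ⟦+n⟧ i = trans (cong (λ j → ⟦ i + j ⟧) (sym (+-identityʳ n))) (⟦+kn⟧ i 1)

  ⊕-assoc : ∀ a b c → (a ⊕ b) ⊕ c ≡ a ⊕ (b ⊕ c)
  ⊕-assoc a b c = begin
    (a ⊕ b) ⊕ c                     ≡⟨ cong ((a ⊕ b) ⊕_) (⟦toℕ⟧ c) ⟨
    (a ⊕ b) ⊕ ⟦ toℕ c ⟧             ≡⟨ ⟦⟧-⊕ (toℕ a + toℕ b) (toℕ c) ⟩
    ⟦ toℕ a + toℕ b + toℕ c ⟧       ≡⟨ cong ⟦_⟧ (+-assoc (toℕ a) (toℕ b) (toℕ c)) ⟩
    ⟦ toℕ a + (toℕ b + toℕ c) ⟧     ≡⟨ ⟦⟧-⊕ (toℕ a) (toℕ b + toℕ c) ⟨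
    ⟦ toℕ a ⟧ ⊕ (b ⊕ c)             ≡⟨ cong (_⊕ (b ⊕ c)) (⟦toℕ⟧ a) ⟩
    a ⊕ (b ⊕ c)                     ∎
    where open ≡-Reasoning

  ⊕-comm : ∀ a b → a ⊕ b ≡ b ⊕ a
  ⊕-comm a b = cong ⟦_⟧ (+-comm (toℕ a) (toℕ b))

  ⊕-identityˡ : ∀ a → zero ⊕ a ≡ a
  ⊕-identityˡ = ⟦toℕ⟧

  ⊕-inverseʳ : ∀ a → a ⊕ ⊖ a ≡ zero
  ⊕-inverseʳ a = begin
    a ⊕ ⊖ a                       ≡⟨ cong (_⊕ ⊖ a) (⟦toℕ⟧ a) ⟨
    ⟦ toℕ a ⟧ ⊕ ⊖ a               ≡⟨ ⟦⟧-⊕ (toℕ a) (n ∸ toℕ a) ⟩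
    ⟦ toℕ a + (n ∸ toℕ a) ⟧       ≡⟨ cong ⟦_⟧ (m+[n∸m]≡n (<⇒≤ (toℕ<n a))) ⟩
    ⟦ n ⟧                         ≡⟨ ⟦+n⟧ 0 ⟩
    zero                          ∎
    where open ≡-Reasoning

  isAbelianGroup : IsAbelianGroup _≡_ _⊕_ zero ⊖_
  isAbelianGroup = record
    { isGroup = record
      { isMonoid = record
        { isSemigroup = record
          { isMagma = record { isEquivalence = isEquivalence ; ∙-cong = cong₂ _⊕_ }
          ; assoc = ⊕-assoc
          }
        ; identity = ⊕-identityˡ , λ a → trans (⊕-comm a zero) (⊕-identityˡ a)
        }
      ; inverse = (λ a → trans (⊕-comm (⊖ a) a) (⊕-inverseʳ a)) , ⊕-inverseʳ
      ; ⁻¹-cong = cong ⊖_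
      }
    ; comm = ⊕-comm
    }

  abelianGroup : AbelianGroup 0ℓ 0ℓ
  abelianGroup = record { isAbelianGroup = isAbelianGroup }

  open AbelianGroupProperties abelianGroup public using (∙-cancelˡ)
  open CommutativeSemigroupProperties (AbelianGroup.commutativeSemigroup abelianGroup) public
    using (interchange)

  ⊕-⟦1⟧ : ∀ {a b} → toℕ b ≡ suc (toℕ a) → a ⊕ ⟦ 1 ⟧ ≡ b
  ⊕-⟦1⟧ {a} {b} eq = begin
    a ⊕ ⟦ 1 ⟧             ≡⟨ cong (_⊕ ⟦ 1 ⟧) (⟦toℕ⟧ a) ⟨
    ⟦ toℕ a ⟧ ⊕ ⟦ 1 ⟧     ≡⟨ ⟦⟧-⊕ (toℕ a) 1 ⟩
    ⟦ toℕ a + 1 ⟧         ≡⟨ cong ⟦_⟧ (trans (+-comm (toℕ a) 1) (sym eq)) ⟩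
    ⟦ toℕ b ⟧             ≡⟨ ⟦toℕ⟧ b ⟩
    b                     ∎
    where open ≡-Reasoning

  Succ⇒⊕ : ∀ {a b} → Succ n a b → a ⊕ ⟦ 1 ⟧ ≡ b
  Succ⇒⊕ (inj₁ eq) = ⊕-⟦1⟧ eq
  Succ⇒⊕ {a} {zero} (inj₂ (eq , _)) = begin
    a ⊕ ⟦ 1 ⟧             ≡⟨ cong (_⊕ ⟦ 1 ⟧) (⟦toℕ⟧ a) ⟨
    ⟦ toℕ a ⟧ ⊕ ⟦ 1 ⟧     ≡⟨ ⟦⟧-⊕ (toℕ a) 1 ⟩
    ⟦ toℕ a + 1 ⟧         ≡⟨ cong ⟦_⟧ (trans (+-comm (toℕ a) 1) eq) ⟩
    ⟦ n ⟧                 ≡⟨ ⟦+n⟧ 0 ⟩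
    zero                  ∎
    where open ≡-Reasoning
  Succ⇒⊕ {a} {suc b} (inj₂ (_ , ()))

-- Neighbours in the cyclic order

Succ-pred : ∀ {h} (j : Fin h) → ∃ λ i → Succ h i j
Succ-pred {suc h} zero    = fromℕ h , inj₂ (cong suc (toℕ-fromℕ h) , refl)
Succ-pred {suc h} (suc j) = inject₁ j , inj₁ (cong suc (sym (toℕ-inject₁ j)))

Succ-next : ∀ {h} (i : Fin h) → ∃ λ j → Succ h i j
Succ-next {suc zero}    zero    = zero , inj₂ (refl , refl)
Succ-next {suc (suc h)} zero    = 1F , inj₁ refl
Succ-next {suc (suc h)} (suc i) with Succ-next i
... | j , inj₁ p       = suc j , inj₁ (cong suc p)
... | j , inj₂ (p , _) = zero , inj₂ (cong suc p , refl)

-- 1-factorisations with a distinguished 1-factor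

-- Colour `nothing` is the matching (k , 0) ~ (k , 1); each d : D colours one
-- further 1-factor, whose edges are those joining orient d (k , 0) to orient d (k , 1).
record Factorisation (K D : Set) : Set where
  field
    col           : K × Fin 2 → K × Fin 2 → Maybe D
    col-sym       : ∀ u v → col u v ≡ col v u
    col-nothing   : ∀ u v → col u v ≡ nothing → proj₁ u ≡ proj₁ v
    nothing-col   : ∀ k b c → col (k , b) (k , c) ≡ nothing
    col-injective : ∀ u v w d → col u v ≡ just d → col u w ≡ just d → v ≡ w
    orient        : D → (K × Fin 2) ↔ (K × Fin 2)
    orient-col    : ∀ d k → col (to (orient d) (k , 0F)) (to (orient d) (k , 1F)) ≡ just d

  private
    third : ∀ {b c d : Fin 2} → c ≢ b → d ≢ b → c ≡ d
    third {0F} {0F} p q = contradiction refl p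
    third {0F} {1F} {0F} p q = contradiction refl q
    third {0F} {1F} {1F} p q = refl
    third {1F} {1F} p q = contradiction refl p
    third {1F} {0F} {1F} p q = contradiction refl q
    third {1F} {0F} {0F} p q = refl

  -- For a colour `just d` this is `col-injective`. For `nothing`, v and w both lie over the same k
  -- as u, and only one of the two points there differs from u. Loops also have colour `nothing`,
  -- hence the two inequalities.
  col-proper : ∀ u v w → v ≢ u → w ≢ u → col u v ≡ col u w → v ≡ w
  col-proper u v w v≢u w≢u eq with col u v in ev | col u w in ew
  ... | just d  | just e = col-injective u v w d ev (trans ew (sym eq))
  ... | nothing | nothing with col-nothing u v ev | col-nothing u w ew
  ...   | refl | refl = cong (proj₁ u ,_)
          (third {b = proj₂ u} (λ { refl → v≢u refl }) (λ { refl → w≢u refl }))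
  col-proper u v w v≢u w≢u () | just _ | nothing
  col-proper u v w v≢u w≢u () | nothing | just _

-- The round-robin 1-factorisation of the complete graph on 2(m + 1) points

module RoundRobin (m : ℕ) where

  open Cyclic (m + m) public

  -- Vertex (j , 0) is the residue j, except that (0 , 0) is the point at
  -- infinity; vertex (j , 1) is the residue − j.
  ι : (Fin (suc m) × Fin 2) ↔ Maybe (Fin n)
  ι = mk↔ₛ′ f g f∘g g∘f
    where
    f : Fin (suc m) × Fin 2 → Maybe (Fin n)
    f (zero  , 0F) = nothing
    f (zero  , 1F) = just zero
    f (suc j , 0F) = just (suc (j ↑ˡ m))
    f (suc j , 1F) = just (suc (m ↑ʳ opposite j))

    g′ : Fin m ⊎ Fin m → Fin (suc m) × Fin 2
    g′ (inj₁ j) = suc j , 0F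
    g′ (inj₂ j) = suc (opposite j) , 1F

    g : Maybe (Fin n) → Fin (suc m) × Fin 2
    g nothing        = zero , 0F
    g (just zero)    = zero , 1F
    g (just (suc c)) = g′ (splitAt m c)

    f∘g : ∀ a → f (g a) ≡ a
    f∘g nothing     = refl
    f∘g (just zero) = refl
    f∘g (just (suc c)) with splitAt m c in eq
    ... | inj₁ j = cong (just ∘ suc) (splitAt⁻¹-↑ˡ eq)
    ... | inj₂ j = cong (just ∘ suc)
            (trans (cong (m ↑ʳ_) (opposite-involutive j)) (splitAt⁻¹-↑ʳ eq))

    g∘f : ∀ u → g (f u) ≡ u
    g∘f (zero  , 0F) = refl
    g∘f (zero  , 1F) = refl
    g∘f (suc j , 0F) = cong g′ (splitAt-↑ˡ m j m)
    g∘f (suc j , 1F) = trans (cong g′ (splitAt-↑ʳ m m (opposite j)))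
      (cong (λ i → suc i , 1F) (opposite-involutive j))

  -- The edge from a to infinity receives 2a, the one sum that edges a + b with b ≠ a leave free at
  -- a.
  sumCol : Maybe (Fin n) → Maybe (Fin n) → Fin n
  sumCol (just a) (just b) = a ⊕ b
  sumCol (just a) nothing  = a ⊕ a
  sumCol nothing  (just b) = b ⊕ b
  sumCol nothing  nothing  = zero

  sumCol-sym : ∀ p q → sumCol p q ≡ sumCol q p
  sumCol-sym (just a) (just b) = ⊕-comm a b
  sumCol-sym (just a) nothing  = refl
  sumCol-sym nothing  (just b) = refl
  sumCol-sym nothing  nothing  = refl

  -- Since 2(m + 1) = n + 1, multiplication by m + 1 is division by 2 modulo n.
  half : Fin n → Fin n
  half a = ⟦ toℕ a * suc m ⟧

  private
    half-⟦⟧ : ∀ i → half ⟦ i ⟧ ≡ ⟦ i * suc m ⟧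
    half-⟦⟧ i = ⟦⟧-≡ (toℕ ⟦ i ⟧ * suc m) (i * suc m) (begin
      (toℕ ⟦ i ⟧ * suc m) % n              ≡⟨ cong (λ j → (j * suc m) % n) (toℕ-⟦⟧ i) ⟩
      (i % n * suc m) % n                  ≡⟨ %-distribˡ-* (i % n) (suc m) n ⟩
      ((i % n % n) * (suc m % n)) % n      ≡⟨ cong (λ j → (j * (suc m % n)) % n) (m%n%n≡m%n i n) ⟩
      ((i % n) * (suc m % n)) % n          ≡⟨ %-distribˡ-* i (suc m) n ⟨
      (i * suc m) % n                      ∎)
      where open ≡-Reasoning

    twice-half : ∀ i → (i + i) * suc m ≡ i + i * n
    twice-half i = solve 2 (λ i m → (i :+ i) :* (con 1 :+ m) := i :+ i :* (con 1 :+ (m :+ m))) refl i m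
      where open +-*-Solver

  half-⊕ : ∀ a → half (a ⊕ a) ≡ a
  half-⊕ a = begin
    half (a ⊕ a)                      ≡⟨ half-⟦⟧ (toℕ a + toℕ a) ⟩
    ⟦ (toℕ a + toℕ a) * suc m ⟧       ≡⟨ cong ⟦_⟧ (twice-half (toℕ a)) ⟩
    ⟦ toℕ a + toℕ a * n ⟧             ≡⟨ ⟦+kn⟧ (toℕ a) (toℕ a) ⟩
    ⟦ toℕ a ⟧                         ≡⟨ ⟦toℕ⟧ a ⟩
    a                                 ∎
    where open ≡-Reasoning

  half⊕half : ∀ a → half a ⊕ half a ≡ a
  half⊕half a = begin
    half a ⊕ half a                             ≡⟨ ⟦⟧-⊕ (toℕ a * suc m) (toℕ a * suc m) ⟩
    ⟦ toℕ a * suc m + toℕ a * suc m ⟧           ≡⟨ cong ⟦_⟧ (*-distribʳ-+ (suc m) (toℕ a) (toℕ a)) ⟨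
    ⟦ (toℕ a + toℕ a) * suc m ⟧                 ≡⟨ cong ⟦_⟧ (twice-half (toℕ a)) ⟩
    ⟦ toℕ a + toℕ a * n ⟧                       ≡⟨ ⟦+kn⟧ (toℕ a) (toℕ a) ⟩
    ⟦ toℕ a ⟧                                   ≡⟨ ⟦toℕ⟧ a ⟩
    a                                           ∎
    where open ≡-Reasoning

  -- At a finite p this is cancellation, the sum 2a being reserved for infinity. At infinity it is
  -- the injectivity of doubling modulo the odd number n.
  sumCol-proper : ∀ p q r → q ≢ p → r ≢ p → sumCol p q ≡ sumCol p r → q ≡ r
  sumCol-proper (just a) (just b) (just c) _ _ eq = cong just (∙-cancelˡ a b c eq)
  sumCol-proper (just a) (just b) nothing q≢p _ eq =
    contradiction (cong just (∙-cancelˡ a b a eq)) q≢p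
  sumCol-proper (just a) nothing (just c) _ r≢p eq =
    contradiction (cong just (∙-cancelˡ a c a (sym eq))) r≢p
  sumCol-proper (just a) nothing nothing _ _ _ = refl
  sumCol-proper nothing nothing _ q≢p _ _ = contradiction refl q≢p
  sumCol-proper nothing (just b) nothing _ r≢p _ = contradiction refl r≢p
  sumCol-proper nothing (just b) (just c) _ _ eq =
    cong just (trans (sym (half-⊕ b)) (trans (cong half eq) (half-⊕ c)))

  rotate : Fin n → Maybe (Fin n) → Maybe (Fin n)
  rotate h = Maybe.map (h ⊕_)

  rotate↔ : Fin n → Maybe (Fin n) ↔ Maybe (Fin n)
  rotate↔ h = mk↔ₛ′ (rotate h) (rotate (⊖ h)) inv₁ inv₂
    where
    open AbelianGroupProperties abelianGroup using (\\-leftDividesˡ; \\-leftDividesʳ)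
    inv₁ : ∀ p → rotate h (rotate (⊖ h) p) ≡ p
    inv₁ nothing  = refl
    inv₁ (just a) = cong just (\\-leftDividesˡ h a)
    inv₂ : ∀ p → rotate (⊖ h) (rotate h p) ≡ p
    inv₂ nothing  = refl
    inv₂ (just a) = cong just (\\-leftDividesʳ h a)

  -- Both summands shift by h. At infinity the finite end is counted twice, so the shift is again
  -- 2h.
  sumCol-rotate : ∀ h p q → p ≢ q → sumCol (rotate h p) (rotate h q) ≡ (h ⊕ h) ⊕ sumCol p q
  sumCol-rotate h (just a) (just b) _ = interchange h a h b
  sumCol-rotate h (just a) nothing  _ = interchange h a h a
  sumCol-rotate h nothing  (just b) _ = interchange h b h b
  sumCol-rotate h nothing  nothing  p≢q = contradiction refl p≢q

  private
    wrap : ∀ {s} r → s ≡ r + n → ⟦ s ⟧ ≡ ⟦ r ⟧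
    wrap r eq = trans (cong ⟦_⟧ eq) (⟦+n⟧ r)

    toℕ-opposite : ∀ (j : Fin m) → toℕ (opposite j) + suc (toℕ j) ≡ m
    toℕ-opposite j = trans (cong (_+ suc (toℕ j)) (opposite-prop j)) (m∸n+n≡m (toℕ<n j))

  ι-swap : ∀ j → sumCol (to ι (j , 0F)) (to ι (j , 1F)) ≡ zero
  ι-swap zero    = refl
  ι-swap (suc j) = wrap 0 (begin
    suc (toℕ (j ↑ˡ m)) + suc (toℕ (m ↑ʳ opposite j))   ≡⟨ cong₂ (λ a b → suc a + suc b) (toℕ-↑ˡ j m) (toℕ-↑ʳ m (opposite j)) ⟩
    suc i + suc (m + o)                                ≡⟨ solve 3 (λ i m o → con 1 :+ i :+ (con 1 :+ (m :+ o)) := con 1 :+ (m :+ (o :+ (con 1 :+ i)))) refl i m o ⟩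
    suc (m + (o + suc i))                              ≡⟨ cong (λ a → suc (m + a)) (toℕ-opposite j) ⟩
    n                                                  ∎)
    where
    open ≡-Reasoning
    open +-*-Solver
    i = toℕ j
    o = toℕ (opposite j)

  -- -i + (i + 1) = 1, and the closing edge from -m to infinity has sum -2m = 1 modulo 2m + 1. With
  -- `ι-swap`, the sums 0 and 1 trace the Hamiltonian cycle ∞, 0, 1, -1, 2, -2, ..., m, -m.
  ι-step : ∀ i j → Succ (suc m) i j → sumCol (to ι (i , 1F)) (to ι (j , 0F)) ≡ ⟦ 1 ⟧
  ι-step i zero (inj₁ ())
  ι-step zero (suc j) (inj₁ eq) = cong (λ a → ⟦ suc a ⟧) (trans (toℕ-↑ˡ j m) (suc-injective eq))
  ι-step (suc i) (suc j) (inj₁ eq) = wrap 1 (begin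
    suc (toℕ (m ↑ʳ opposite i)) + suc (toℕ (j ↑ˡ m))   ≡⟨ cong₂ (λ a b → suc a + suc b) (toℕ-↑ʳ m (opposite i)) (trans (toℕ-↑ˡ j m) (suc-injective eq)) ⟩
    suc (m + o) + suc (suc k)                          ≡⟨ solve 3 (λ k m o → con 1 :+ (m :+ o) :+ (con 2 :+ k) := con 2 :+ (m :+ (o :+ (con 1 :+ k)))) refl k m o ⟩
    suc (suc (m + (o + suc k)))                        ≡⟨ cong (λ a → suc (suc (m + a))) (toℕ-opposite i) ⟩
    1 + n                                              ∎)
    where
    open ≡-Reasoning
    open +-*-Solver
    k = toℕ i
    o = toℕ (opposite i)
  ι-step i (suc j) (inj₂ (_ , ()))
  ι-step zero zero (inj₂ (refl , _)) = refl
  ι-step (suc i) zero (inj₂ (eq , _)) = wrap 1 (begin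
    suc (toℕ (m ↑ʳ opposite i)) + suc (toℕ (m ↑ʳ opposite i))   ≡⟨ cong (λ a → suc a + suc a) (trans (toℕ-↑ʳ m (opposite i)) (cong (m +_) o≡0)) ⟩
    suc (m + 0) + suc (m + 0)                                   ≡⟨ solve 1 (λ m → con 1 :+ (m :+ con 0) :+ (con 1 :+ (m :+ con 0)) := con 2 :+ (m :+ m)) refl m ⟩
    1 + n                                                       ∎)
    where
    open ≡-Reasoning
    open +-*-Solver
    o≡0 : toℕ (opposite i) ≡ 0
    o≡0 = +-cancelʳ-≡ (suc (toℕ i)) (toℕ (opposite i)) 0
      (trans (toℕ-opposite i) (sym (suc-injective eq)))

  -- The nonzero sums in consecutive pairs: (r , b) stands for 2r + 1 + b, so that each r will give
  -- one Hamiltonian cycle.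
  Colour : Set
  Colour = Fin m × Fin 2

  pair : Colour ↔ Fin (m + m)
  pair = ↔-trans (↔-sym *↔×)
    (mk↔ₛ′ (cast m*2≡m+m) (cast (sym m*2≡m+m))
      (λ c → trans (cast-trans (sym m*2≡m+m) m*2≡m+m c) (cast-is-id refl c))
      (λ c → trans (cast-trans m*2≡m+m (sym m*2≡m+m) c) (cast-is-id refl c)))
    where
    m*2≡m+m : m * 2 ≡ m + m
    m*2≡m+m = trans (*-comm m 2) (cong (m +_) (+-identityʳ m))

  toℕ-pair : ∀ r b → toℕ (to pair (r , b)) ≡ 2 * toℕ r + toℕ b
  toℕ-pair r b = trans (toℕ-cast _ (combine r b)) (toℕ-combine r b)

  residue : Colour → Fin n
  residue d = suc (to pair d)

  residue-next : ∀ r → residue (r , 0F) ⊕ ⟦ 1 ⟧ ≡ residue (r , 1F)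
  residue-next r = ⊕-⟦1⟧ (cong suc (trans (toℕ-pair r 1F)
    (trans (+-suc (2 * toℕ r) 0) (cong suc (sym (toℕ-pair r 0F))))))

  sumCol-swap : ∀ (u v : Fin (suc m) × Fin 2) → proj₁ u ≡ proj₁ v → u ≢ v →
    sumCol (to ι u) (to ι v) ≡ zero
  sumCol-swap (k , 0F) (.k , 0F) refl u≢v = contradiction refl u≢v
  sumCol-swap (k , 0F) (.k , 1F) refl u≢v = ι-swap k
  sumCol-swap (k , 1F) (.k , 0F) refl u≢v = trans (sumCol-sym (to ι (k , 1F)) (to ι (k , 0F))) (ι-swap k)
  sumCol-swap (k , 1F) (.k , 1F) refl u≢v = contradiction refl u≢v

  decode : Fin n → Maybe Colour
  decode zero    = nothing
  decode (suc c) = just (from pair c)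

  -- The test on first components gives loops the colour `nothing` too; the sum 2a at a loop may be
  -- nonzero.
  col : Fin (suc m) × Fin 2 → Fin (suc m) × Fin 2 → Maybe Colour
  col u v with proj₁ u ≟ proj₁ v
  ... | yes _ = nothing
  ... | no  _ = decode (sumCol (to ι u) (to ι v))

  col-intro : ∀ u v d → u ≢ v → sumCol (to ι u) (to ι v) ≡ residue d → col u v ≡ just d
  col-intro u v d u≢v eq with proj₁ u ≟ proj₁ v
  ... | yes p = contradiction (trans (sym (sumCol-swap u v p u≢v)) eq) λ ()
  ... | no  _ rewrite eq = cong just (strictlyInverseʳ pair d)

  col-elim : ∀ u v d → col u v ≡ just d → u ≢ v × sumCol (to ι u) (to ι v) ≡ residue d
  col-elim u v d eq with proj₁ u ≟ proj₁ v
  col-elim u v d () | yes _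
  ... | no  p with sumCol (to ι u) (to ι v)
  col-elim u v d () | no p | zero
  ... | suc c = (λ { refl → p refl }) ,
    cong suc (trans (sym (strictlyInverseˡ pair c)) (cong (to pair) (just-injective eq)))

  -- The partner of u over the same k already realises the sum 0 at u, so by properness v is that
  -- partner.
  col-nothing : ∀ u v → col u v ≡ nothing → proj₁ u ≡ proj₁ v
  col-nothing u v eq with proj₁ u ≟ proj₁ v
  ... | yes p = p
  ... | no  p with sumCol (to ι u) (to ι v) in ev
  col-nothing u v () | no p | suc c
  col-nothing (k , b) v eq | no p | zero =
    cong proj₁ (to-injective ι (sumCol-proper (to ι (k , b)) (to ι (k , opposite b)) (to ι v)
      (λ e → opposite-≢ b (cong proj₂ (to-injective ι e)))
      (λ e → p (cong proj₁ (sym (to-injective ι e))))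
      (trans (sumCol-swap (k , b) (k , opposite b) refl (λ e → opposite-≢ b (cong proj₂ (sym e)))) (sym ev))))
    where
    opposite-≢ : ∀ (b : Fin 2) → opposite b ≢ b
    opposite-≢ 0F ()
    opposite-≢ 1F ()

  -- Translation by c / 2 adds c to every sum, so it carries the 1-factor of sum 0 onto that of sum
  -- c, and sum 1 onto c + 1.
  orient : Fin n → (Fin (suc m) × Fin 2) ↔ (Fin (suc m) × Fin 2)
  orient c = ↔-trans ι (↔-trans (rotate↔ (half c)) (↔-sym ι))

  orient-sumCol : ∀ c u v → u ≢ v →
    sumCol (to ι (to (orient c) u)) (to ι (to (orient c) v)) ≡ c ⊕ sumCol (to ι u) (to ι v)
  orient-sumCol c u v u≢v = begin
    sumCol (to ι (to (orient c) u)) (to ι (to (orient c) v))             ≡⟨ cong₂ sumCol (strictlyInverseˡ ι (rotate (half c) (to ι u))) (strictlyInverseˡ ι (rotate (half c) (to ι v))) ⟩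
    sumCol (rotate (half c) (to ι u)) (rotate (half c) (to ι v))         ≡⟨ sumCol-rotate (half c) (to ι u) (to ι v) (u≢v ∘ to-injective ι) ⟩
    (half c ⊕ half c) ⊕ sumCol (to ι u) (to ι v)                         ≡⟨ cong (_⊕ sumCol (to ι u) (to ι v)) (half⊕half c) ⟩
    c ⊕ sumCol (to ι u) (to ι v)                                         ∎
    where open ≡-Reasoning

  orient-col : ∀ c d u v → u ≢ v → c ⊕ sumCol (to ι u) (to ι v) ≡ residue d →
    col (to (orient c) u) (to (orient c) v) ≡ just d
  orient-col c d u v u≢v eq =
    col-intro _ _ d (u≢v ∘ to-injective (orient c)) (trans (orient-sumCol c u v u≢v) eq)

  factorisation : Factorisation (Fin (suc m)) Colour
  factorisation = record
    { col           = col
    ; col-sym       = symm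
    ; col-nothing   = col-nothing
    ; nothing-col   = same
    ; col-injective = inj
    ; orient        = orient ∘ residue
    ; orient-col    = λ d k → orient-col (residue d) d (k , 0F) (k , 1F) (λ ())
        (trans (cong (residue d ⊕_) (ι-swap k))
          (trans (⊕-comm (residue d) zero) (⊕-identityˡ (residue d))))
    }
    where
    symm : ∀ u v → col u v ≡ col v u
    symm u v with proj₁ u ≟ proj₁ v | proj₁ v ≟ proj₁ u
    ... | yes _ | yes _ = refl
    ... | yes p | no  q = contradiction (sym p) q
    ... | no  p | yes q = contradiction (sym q) p
    ... | no  _ | no  _ = cong decode (sumCol-sym (to ι u) (to ι v))
    same : ∀ k b c → col (k , b) (k , c) ≡ nothing
    same k b c with k ≟ k
    ... | yes _ = refl
    ... | no  p = contradiction refl p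
    inj : ∀ u v w d → col u v ≡ just d → col u w ≡ just d → v ≡ w
    inj u v w d p q with col-elim u v d p | col-elim u w d q
    ... | u≢v , p′ | u≢w , q′ = to-injective ι (sumCol-proper (to ι u) (to ι v) (to ι w)
      (λ e → u≢v (sym (to-injective ι e))) (λ e → u≢w (sym (to-injective ι e)))
      (trans p′ (sym q′)))

  hamiltonian : ∀ r i j → Succ (suc m) i j →
    col (to (orient (residue (r , 0F))) (i , 1F)) (to (orient (residue (r , 0F))) (j , 0F)) ≡ just (r , 1F)
  hamiltonian r i j s = orient-col (residue (r , 0F)) (r , 1F) (i , 1F) (j , 0F) (λ ())
    (trans (cong (residue (r , 0F) ⊕_) (ι-step i j s)) (residue-next r))

-- Blowing up each point of a 1-factorised graph into m + 1 points

module BlowUp {K D : Set} (A : Factorisation K D) (m : ℕ) where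

  private
    module A = Factorisation A
    module R = RoundRobin m
    module B = Factorisation R.factorisation

  open Cyclic m public
  open AbelianGroupProperties abelianGroup using (⁻¹-involutive; \\-leftDividesˡ)

  S : Set
  S = Fin (suc m)

  Vertex : Set
  Vertex = (K × S) × Fin 2

  Colour : Set
  Colour = R.Colour ⊎ (D × S)

  signed : Fin 2 → S → S
  signed 0F i = i
  signed 1F i = ⊖ i

  signed-involutive : ∀ b i → signed b (signed b i) ≡ i
  signed-involutive 0F i = refl
  signed-involutive 1F i = ⁻¹-involutive i

  -- The round-robin colour e counts where A gives `nothing`, that is, inside a copy of the complete
  -- graph on {k} × S × {0, 1}.
  colour : Maybe D → Maybe R.Colour → S → Maybe Colour
  colour (just d) _ c = just (inj₂ (d , c))
  colour nothing  e _ = Maybe.map inj₁ e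

  private
    colour-nothing : ∀ a e {s} → colour a e s ≡ nothing → a ≡ nothing × e ≡ nothing
    colour-nothing nothing nothing _ = refl , refl

    colour-inj₁ : ∀ a {e s x} → colour a e s ≡ just (inj₁ x) → a ≡ nothing × e ≡ just x
    colour-inj₁ nothing {just _} refl = refl , refl

    colour-inj₂ : ∀ a e {s d c} → colour a e s ≡ just (inj₂ (d , c)) → a ≡ just d × s ≡ c
    colour-inj₂ (just _) _ refl = refl , refl
    colour-inj₂ nothing (just _) ()

  -- The sum of signed coordinates is symmetric in the two ends, so no orientation of
  -- the edge is needed; the signs cancel along edges joining (k , i , 0) to (l , i , 1),
  -- which makes the hexagons close up after six steps.
  col : Vertex → Vertex → Maybe Colour
  col ((k , i) , b) ((l , j) , c) =
    colour (A.col (k , b) (l , c)) (B.col (i , b) (j , c)) (signed b i ⊕ signed c j)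

  col-inner : ∀ k i b j c e → B.col (i , b) (j , c) ≡ just e →
    col ((k , i) , b) ((k , j) , c) ≡ just (inj₁ e)
  col-inner k i b j c e eq rewrite A.nothing-col k b c | eq = refl

  col-outer : ∀ k i b l j c d → A.col (k , b) (l , c) ≡ just d →
    col ((k , i) , b) ((l , j) , c) ≡ just (inj₂ (d , signed b i ⊕ signed c j))
  col-outer k i b l j c d eq rewrite eq = refl

  reflect : S → Fin 2 → S → S
  reflect c 0F i = i
  reflect c 1F i = ⊖ i ⊕ c

  reflect-involutive : ∀ c b i → reflect c b (reflect c b i) ≡ i
  reflect-involutive c 0F i = refl
  reflect-involutive c 1F i = ∙-cancelˡ (⊖ i ⊕ c) _ _ (begin
    (⊖ i ⊕ c) ⊕ (⊖ (⊖ i ⊕ c) ⊕ c)   ≡⟨ \\-leftDividesˡ (⊖ i ⊕ c) c ⟩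
    c                                 ≡⟨ \\-leftDividesˡ i c ⟨
    i ⊕ (⊖ i ⊕ c)                     ≡⟨ ⊕-comm i (⊖ i ⊕ c) ⟩
    (⊖ i ⊕ c) ⊕ i                     ∎)
    where open ≡-Reasoning

  innerOrient : R.Colour → Vertex ↔ Vertex
  innerOrient e = ↔-trans (×-assoc 0ℓ K S (Fin 2))
    (↔-trans (×-cong ↔-refl (B.orient e)) (↔-sym (×-assoc 0ℓ K S (Fin 2))))

  -- The image of (k , i , 0) has signed coordinate i and that of (k , i , 1) has c - i. Along (0 ,
  -- 0), (0 , 1), (1 , 0), (1 , 1), ... the sums therefore alternate between c and c + 1. The outer
  -- `signed` uses the new bit `b′`, since `A.orient d` may change the bit.
  crossOrient : D → S → Vertex ↔ Vertex
  crossOrient d c = mk↔ₛ′ f g f∘g g∘f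
    where
    o = A.orient d
    f : Vertex → Vertex
    f ((k , i) , b) with to o (k , b)
    ... | k′ , b′ = (k′ , signed b′ (reflect c b i)) , b′
    g : Vertex → Vertex
    g ((k , i) , b) with from o (k , b)
    ... | k′ , b′ = (k′ , reflect c b′ (signed b i)) , b′
    f∘g : ∀ u → f (g u) ≡ u
    f∘g ((k , i) , b) with from o (k , b) in eq
    ... | k′ , b′ with to o (k′ , b′) | trans (cong (to o) (sym eq)) (strictlyInverseˡ o (k , b))
    ...   | _ | refl = cong (λ j → (k , j) , b)
            (trans (cong (signed b) (reflect-involutive c b′ (signed b i))) (signed-involutive b i))
    g∘f : ∀ u → g (f u) ≡ u
    g∘f ((k , i) , b) with to o (k , b) in eq
    ... | k′ , b′ with from o (k′ , b′) | trans (cong (from o) (sym eq)) (strictlyInverseʳ o (k , b))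
    ...   | _ | refl = cong (λ j → (k , j) , b)
            (trans (cong (reflect c b) (signed-involutive b′ (reflect c b i))) (reflect-involutive c b i))

  crossOrient-col : ∀ d c k i j →
    col (to (crossOrient d c) ((k , i) , 0F)) (to (crossOrient d c) ((k , j) , 1F))
      ≡ just (inj₂ (d , i ⊕ (⊖ j ⊕ c)))
  crossOrient-col d c k i j with to (A.orient d) (k , 0F) | to (A.orient d) (k , 1F) | A.orient-col d k
  ... | k′ , b′ | l′ , c′ | eq rewrite eq =
    cong (λ a → just (inj₂ (d , a)))
      (cong₂ _⊕_ (signed-involutive b′ i) (signed-involutive c′ (⊖ j ⊕ c)))

  orient : Colour → Vertex ↔ Vertex
  orient (inj₁ e)       = innerOrient e
  orient (inj₂ (d , c)) = crossOrient d c

  factorisation : Factorisation (K × S) Colour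
  factorisation = record
    { col           = col
    ; col-sym       = symm
    ; col-nothing   = noth
    ; nothing-col   = same
    ; col-injective = inj
    ; orient        = orient
    ; orient-col    = orc
    }
    where
    symm : ∀ u v → col u v ≡ col v u
    symm ((k , i) , b) ((l , j) , c)
      rewrite A.col-sym (k , b) (l , c) | B.col-sym (i , b) (j , c) | ⊕-comm (signed b i) (signed c j) = refl
    noth : ∀ u v → col u v ≡ nothing → proj₁ u ≡ proj₁ v
    noth ((k , i) , b) ((l , j) , c) eq with colour-nothing (A.col (k , b) (l , c)) _ eq
    ... | p , q = cong₂ _,_ (A.col-nothing (k , b) (l , c) p) (B.col-nothing (i , b) (j , c) q)
    same : ∀ k b c → col (k , b) (k , c) ≡ nothing
    same (k , i) b c rewrite A.nothing-col k b c | B.nothing-col i b c = refl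
    inj : ∀ u v w d → col u v ≡ just d → col u w ≡ just d → v ≡ w
    inj ((k , i) , b) ((l , j) , c) ((l′ , j′) , c′) (inj₁ e) p q
      with colour-inj₁ (A.col (k , b) (l , c)) p | colour-inj₁ (A.col (k , b) (l′ , c′)) q
    ... | p₁ , p₂ | q₁ , q₂
      with A.col-nothing (k , b) (l , c) p₁ | A.col-nothing (k , b) (l′ , c′) q₁
         | B.col-injective (i , b) (j , c) (j′ , c′) e p₂ q₂
    ... | refl | refl | refl = refl
    inj ((k , i) , b) ((l , j) , c) ((l′ , j′) , c′) (inj₂ (d , s)) p q
      with colour-inj₂ (A.col (k , b) (l , c)) (B.col (i , b) (j , c)) p
         | colour-inj₂ (A.col (k , b) (l′ , c′)) (B.col (i , b) (j′ , c′)) q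
    ... | p₁ , p₂ | q₁ , q₂ with A.col-injective (k , b) (l , c) (l′ , c′) d p₁ q₁
    ... | refl = cong (λ a → (l , a) , c) (begin
      j                        ≡⟨ signed-involutive c j ⟨
      signed c (signed c j)    ≡⟨ cong (signed c) (∙-cancelˡ (signed b i) (signed c j) (signed c j′) (trans p₂ (sym q₂))) ⟩
      signed c (signed c j′)   ≡⟨ signed-involutive c j′ ⟩
      j′                       ∎)
      where open ≡-Reasoning
    orc : ∀ d k → col (to (orient d) (k , 0F)) (to (orient d) (k , 1F)) ≡ just d
    orc (inj₁ e) (k , i) = col-inner k _ _ _ _ e (B.orient-col e i)
    orc (inj₂ (d , c)) (k , i) = trans (crossOrient-col d c k i i)
      (cong (λ a → just (inj₂ (d , a))) (\\-leftDividesˡ i c))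

  -- Read backwards, the edge is an instance of `crossOrient-col` with i and j exchanged: j + (c -
  -- i) = c + 1. The wrap-around from the last index to 0 is covered because j = i + 1 modulo m + 1.
  crossOrient-step : ∀ d c k i j → Succ (suc m) i j →
    col (to (crossOrient d c) ((k , i) , 1F)) (to (crossOrient d c) ((k , j) , 0F))
      ≡ just (inj₂ (d , c ⊕ ⟦ 1 ⟧))
  crossOrient-step d c k i j s =
    trans (Factorisation.col-sym factorisation (to (crossOrient d c) ((k , i) , 1F)) (to (crossOrient d c) ((k , j) , 0F)))
      (trans (crossOrient-col d c k j i) (cong (λ a → just (inj₂ (d , a))) (begin
        j ⊕ (⊖ i ⊕ c)             ≡⟨ cong (_⊕ (⊖ i ⊕ c)) (trans (sym (Succ⇒⊕ s)) (⊕-comm i ⟦ 1 ⟧)) ⟩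
        (⟦ 1 ⟧ ⊕ i) ⊕ (⊖ i ⊕ c)   ≡⟨ ⊕-assoc ⟦ 1 ⟧ i (⊖ i ⊕ c) ⟩
        ⟦ 1 ⟧ ⊕ (i ⊕ (⊖ i ⊕ c))   ≡⟨ cong (⟦ 1 ⟧ ⊕_) (\\-leftDividesˡ i c) ⟩
        ⟦ 1 ⟧ ⊕ c                 ≡⟨ ⊕-comm ⟦ 1 ⟧ c ⟩
        c ⊕ ⟦ 1 ⟧                 ∎)))
    where open ≡-Reasoning

  innerOrient-step : ∀ r k i j → Succ (suc m) i j →
    col (to (innerOrient (r , 0F)) ((k , i) , 1F)) (to (innerOrient (r , 0F)) ((k , j) , 0F))
      ≡ just (inj₁ (r , 1F))
  innerOrient-step r k i j s = col-inner k _ _ _ _ (r , 1F) (R.hamiltonian r i j s)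

-- Consecutive positions 2j + c on a cycle of length 2h

Succ-even : ∀ {h} (j : Fin h) → Succ (h * 2) (combine j 0F) (combine j 1F)
Succ-even j rewrite toℕ-combine {n = 2} j 0F | toℕ-combine {n = 2} j 1F = inj₁ (+-suc (2 * toℕ j) 0)

Succ-odd : ∀ {h} {i j : Fin h} → Succ h i j → Succ (h * 2) (combine i 1F) (combine j 0F)
Succ-odd {h} {i} {j} s rewrite toℕ-combine {n = 2} i 1F | toℕ-combine {n = 2} j 0F with s
... | inj₁ p rewrite p = inj₁ (solve 1 (λ a → con 2 :* (con 1 :+ a) :+ con 0 := con 1 :+ (con 2 :* a :+ con 1)) refl (toℕ i))
  where open +-*-Solver
... | inj₂ (p , q) rewrite q = inj₂
  (trans (solve 1 (λ a → con 1 :+ (con 2 :* a :+ con 1) := (con 1 :+ a) :* con 2) refl (toℕ i)) (cong (_* 2) p) , refl)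
  where open +-*-Solver

-- Consecutive positions 2i + b and 2j + c have opposite parity, also across the wrap-around since
-- the length is even; this leaves two choices of bits.
Succ-combine⁻¹ : ∀ {h} (i j : Fin h) b c → Succ (h * 2) (combine i b) (combine j c) →
  (b ≡ 0F × c ≡ 1F × i ≡ j) ⊎ (b ≡ 1F × c ≡ 0F × Succ h i j)
Succ-combine⁻¹ {h} i j b c s rewrite toℕ-combine i b | toℕ-combine j c = cases b c s
  where
  open +-*-Solver
  cases : ∀ (b c : Fin 2) →
    (2 * toℕ j + toℕ c ≡ suc (2 * toℕ i + toℕ b)) ⊎ (suc (2 * toℕ i + toℕ b) ≡ h * 2 × 2 * toℕ j + toℕ c ≡ 0) →
    (b ≡ 0F × c ≡ 1F × i ≡ j) ⊎ (b ≡ 1F × c ≡ 0F × Succ h i j)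
  cases 0F 0F (inj₁ p) = ⊥-elim (even≢odd (toℕ j) (toℕ i)
    (trans (sym (+-identityʳ _)) (trans p (cong suc (+-identityʳ _)))))
  cases 0F 0F (inj₂ (p , _)) = ⊥-elim (even≢odd h (toℕ i)
    (trans (*-comm 2 h) (trans (sym p) (cong suc (+-identityʳ _)))))
  cases 0F 1F (inj₁ p) = inj₁ (refl , refl , toℕ-injective (sym (*-cancelˡ-≡ (toℕ j) (toℕ i) 2
    (suc-injective (trans (+-comm 1 (2 * toℕ j)) (trans p (cong suc (+-identityʳ _))))))))
  cases 0F 1F (inj₂ (_ , q)) = contradiction (trans (+-comm 1 (2 * toℕ j)) q) λ ()
  cases 1F 0F (inj₁ p) = inj₂ (refl , refl , inj₁ (*-cancelˡ-≡ (toℕ j) (suc (toℕ i)) 2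
    (trans (sym (+-identityʳ _)) (trans p
      (solve 1 (λ a → con 1 :+ (con 2 :* a :+ con 1) := con 2 :* (con 1 :+ a)) refl (toℕ i))))))
  cases 1F 0F (inj₂ (p , q)) = inj₂ (refl , refl , inj₂
    ( *-cancelʳ-≡ (suc (toℕ i)) h 2
        (trans (solve 1 (λ a → (con 1 :+ a) :* con 2 := con 1 :+ (con 2 :* a :+ con 1)) refl (toℕ i)) p)
    , *-cancelˡ-≡ (toℕ j) 0 2 (trans (sym (+-identityʳ _)) q)))
  cases 1F 1F (inj₁ p) = ⊥-elim (even≢odd (toℕ j) (toℕ i)
    (suc-injective (trans (+-comm 1 (2 * toℕ j)) (trans p (cong suc (+-comm (2 * toℕ i) 1))))))
  cases 1F 1F (inj₂ (_ , q)) = contradiction (trans (+-comm 1 (2 * toℕ j)) q) λ ()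

-- Two colours of a proper colouring that alternate around cycles

module AlternatingCycles
  {V C : Set} (col : V → V → C)
  (col-sym : ∀ u v → col u v ≡ col v u)
  (col-proper : ∀ u v w → v ≢ u → w ≢ u → col u v ≡ col u w → v ≡ w)
  {K : Set} {h : ℕ} (a b : C) (ψ : ((K × Fin h) × Fin 2) ↔ V)
  (even-edge : ∀ k j → col (to ψ ((k , j) , 0F)) (to ψ ((k , j) , 1F)) ≡ a)
  (odd-edge : ∀ k i j → Succ h i j → col (to ψ ((k , i) , 1F)) (to ψ ((k , j) , 0F)) ≡ b)
  where

  private
    Label : Set
    Label = (K × Fin h) × Fin 2

    position : Label → Fin (h * 2)
    position ((k , j) , c) = combine j c

    Edge : V → V → Set
    Edge u v = (col u v ≡ a) ⊎ (col u v ≡ b)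

    unique : ∀ p q r {c} → q ≢ p → r ≢ p → col (to ψ p) (to ψ q) ≡ c → col (to ψ p) (to ψ r) ≡ c → q ≡ r
    unique p q r q≢p r≢p e f = to-injective ψ (col-proper (to ψ p) (to ψ q) (to ψ r)
      (q≢p ∘ to-injective ψ) (r≢p ∘ to-injective ψ) (trans e (sym f)))

    flip : ∀ {p q c} → col (to ψ p) (to ψ q) ≡ c → col (to ψ q) (to ψ p) ≡ c
    flip {p} {q} e = trans (col-sym (to ψ q) (to ψ p)) e

    -- Each vertex already has one cycle edge of colour a and one of colour b, and properness allows
    -- no other. The hypothesis `p ≢ q` excludes loops, which have colour a when a is `nothing`.
    adjacent : ∀ p q → p ≢ q → Edge (to ψ p) (to ψ q) →
      proj₁ (proj₁ p) ≡ proj₁ (proj₁ q) × CycAdj (h * 2) (position p) (position q)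
    adjacent p@((k , j) , 0F) q p≢q (inj₁ e)
      with unique p q ((k , j) , 1F) (p≢q ∘ sym) (λ ()) e (even-edge k j)
    ... | refl = refl , inj₁ (Succ-even j)
    adjacent p@((k , j) , 1F) q p≢q (inj₁ e)
      with unique p q ((k , j) , 0F) (p≢q ∘ sym) (λ ()) e (flip (even-edge k j))
    ... | refl = refl , inj₂ (Succ-even j)
    adjacent p@((k , j) , 0F) q p≢q (inj₂ e) with Succ-pred j
    ... | i , s with unique p q ((k , i) , 1F) (p≢q ∘ sym) (λ ()) e (flip (odd-edge k i j s))
    ... | refl = refl , inj₂ (Succ-odd s)
    adjacent p@((k , j) , 1F) q p≢q (inj₂ e) with Succ-next j
    ... | i , s with unique p q ((k , i) , 0F) (p≢q ∘ sym) (λ ()) e (odd-edge k j i s)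
    ... | refl = refl , inj₁ (Succ-odd s)

    step : ∀ p q → proj₁ (proj₁ p) ≡ proj₁ (proj₁ q) → Succ (h * 2) (position p) (position q) →
      p ≢ q × Edge (to ψ p) (to ψ q)
    step ((k , i) , b) ((.k , j) , c) refl s with Succ-combine⁻¹ i j b c s
    ... | inj₁ (refl , refl , refl) = (λ ()) , inj₁ (even-edge k i)
    ... | inj₂ (refl , refl , s′)   = (λ ()) , inj₂ (odd-edge k i j s′)

    adjacent⁻¹ : ∀ p q → proj₁ (proj₁ p) ≡ proj₁ (proj₁ q) → CycAdj (h * 2) (position p) (position q) →
      p ≢ q × Edge (to ψ p) (to ψ q)
    adjacent⁻¹ p q e (inj₁ s) = step p q e s
    adjacent⁻¹ p q e (inj₂ s) with step q p (sym e) s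
    ... | q≢p , inj₁ f = q≢p ∘ sym , inj₁ (flip f)
    ... | q≢p , inj₂ f = q≢p ∘ sym , inj₂ (flip f)

  isCycleFactor : ∀ {v k} (ε : Fin v ↔ V) (κ : K ↔ Fin k) (G : Graph v) →
    (∀ x y → G x y → x ≢ y × ((col (to ε x) (to ε y) ≡ a) ⊎ (col (to ε x) (to ε y) ≡ b))) →
    (∀ x y → x ≢ y → (col (to ε x) (to ε y) ≡ a) ⊎ (col (to ε x) (to ε y) ≡ b) → G x y) →
    IsCycleFactor (h * 2) G
  isCycleFactor {k = k} ε κ G G⇒ ⇒G = record
    { k     = k
    ; label = ↔-trans ε (↔-trans (↔-sym ψ)
                (↔-trans (×-assoc 0ℓ K (Fin h) (Fin 2)) (×-cong κ (↔-sym *↔×))))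
    ; adj   = λ x y →
        (λ g → let x≢y , e = G⇒ x y g
                   same , adj = adjacent (lab x) (lab y) (x≢y ∘ lab-injective) (subst₂ Edge (sym (ψ-lab x)) (sym (ψ-lab y)) e)
               in cong (to κ) same , adj) ,
        (λ (same , adj) →
               let p≢q , e = adjacent⁻¹ (lab x) (lab y) (to-injective κ same) adj
               in ⇒G x y (p≢q ∘ cong lab) (subst₂ Edge (ψ-lab x) (ψ-lab y) e))
    }
    where
    lab : Fin _ → Label
    lab x = from ψ (to ε x)
    ψ-lab : ∀ x → to ψ (lab x) ≡ to ε x
    ψ-lab x = strictlyInverseˡ ψ (to ε x)
    lab-injective : ∀ {x y} → lab x ≡ lab y → x ≡ y
    lab-injective {x} {y} e = to-injective ε (trans (sym (ψ-lab x)) (trans (cong (to ψ) e) (ψ-lab y)))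

-- The decomposition on 6x(t + 1) points, for x = 2(y + 1)

module Solution (y t : ℕ) where

  x : ℕ
  x = suc y * 2

  private
    -- `R₃` is the 1-factorisation of K_6. `B₂` blows up the complete graph on 2(t + 1) points
    -- threefold, so its inner copies are coloured by `R₃`; `B₃` blows up the result x-fold, as x =
    -- 1 + suc (y * 2).
    module R₃ = RoundRobin 2
    module B₂ = BlowUp (RoundRobin.factorisation t) 2
    module B₃ = BlowUp B₂.factorisation (suc (y * 2))
    open Factorisation B₃.factorisation

  -- Sum 1 in the inner copies of K_6. Sum 0 there is the colour `nothing` of `B₂`, so the two are
  -- L₁ and L₀.
  hexagonColour : B₂.Colour
  hexagonColour = inj₁ (0F , 0F)

  -- All six points of a hexagon share the coordinate s, so the signed sum along an edge of L₁ is -s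
  -- + s = 0.
  hexagon-edge : ∀ q s i j → Succ 3 i j →
    col (((q , i) , s) , 1F) (((q , j) , s) , 0F) ≡ just (inj₂ (hexagonColour , 0F))
  hexagon-edge q s i j e =
    trans (B₃.col-outer (q , i) s 1F (q , j) s 0F hexagonColour
            (B₂.col-inner q i 1F j 0F (0F , 0F)
              (R₃.col-intro (i , 1F) (j , 0F) (0F , 0F) (λ ()) (R₃.ι-step i j e))))
      (cong (λ a → just (inj₂ (hexagonColour , a)))
        (trans (B₃.⊕-comm (B₃.⊖ s) s) (B₃.⊕-inverseʳ s)))

  -- A class consists of two colours, except that hexagonClass consists of nothing,
  -- (hexagonColour , 0) and (hexagonColour , 1), the last being the removed 1-factor.
  Class : Set
  Class = (B₂.Colour × Fin (suc y)) ⊎ Fin (suc (y * 2))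

  hexagonClass : Class
  hexagonClass = inj₁ (hexagonColour , 0F)

  class : Maybe B₃.Colour → Class
  class nothing               = hexagonClass
  class (just (inj₁ (r , _))) = inj₂ r
  class (just (inj₂ (d , c))) = inj₁ (d , quotient {suc y} 2 c)

  removed : B₃.Colour
  removed = inj₂ (hexagonColour , 1F)

  combine-next : ∀ (r : Fin (suc y)) → combine r 0F B₃.⊕ B₃.⟦ 1 ⟧ ≡ combine r 1F
  combine-next r = B₃.⊕-⟦1⟧ (trans (toℕ-combine {n = 2} r 1F)
    (trans (+-suc (2 * toℕ r) 0) (cong suc (sym (toℕ-combine {n = 2} r 0F)))))

  quotient⁻¹ : ∀ (c : Fin x) r → quotient {suc y} 2 c ≡ r → (c ≡ combine r 0F) ⊎ (c ≡ combine r 1F)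
  quotient⁻¹ c r refl = cases r (remainder {suc y} 2 c) (combine-remQuot {suc y} 2 c)
    where
    cases : ∀ (r : Fin (suc y)) (b : Fin 2) → combine r b ≡ c → (c ≡ combine r 0F) ⊎ (c ≡ combine r 1F)
    cases r 0F e = inj₁ (sym e)
    cases r 1F e = inj₂ (sym e)

  class-combine : ∀ d r (b : Fin 2) → class (just (inj₂ (d , combine r b))) ≡ inj₁ (d , r)
  class-combine d r b = cong (λ p → inj₁ (d , proj₁ p)) (remQuot-combine {suc y} {2} r b)

  v : ℕ
  v = suc t * 3 * x * 2

  vertices : Fin v ↔ B₃.Vertex
  vertices = ↔-trans *↔× (×-cong (↔-trans *↔× (×-cong *↔× ↔-refl)) ↔-refl)

  classes : ℕ
  classes = (2 * 2 + t * 2 * 3) * suc y + suc (y * 2)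

  index : Fin classes ↔ Class
  index = ↔-trans +↔⊎
    (↔-trans *↔× (×-cong (↔-trans +↔⊎ (*↔× ⊎-cong ↔-trans *↔× (×-cong *↔× ↔-refl))) ↔-refl) ⊎-cong ↔-refl)

  colᵥ : Fin v → Fin v → Maybe B₃.Colour
  colᵥ a b = col (to vertices a) (to vertices b)

  -- Without `a ≢ b`, loops, having colour `nothing`, would enter the hexagon class.
  factor : Class → Graph v
  factor φ a b = a ≢ b × colᵥ a b ≢ just removed × class (colᵥ a b) ≡ φ

  private
    module Cycles {K : Set} {h : ℕ} = AlternatingCycles col col-sym col-proper {K} {h}

  -- Each class is a cycle factor

  classFactor : ∀ {K h k} φ a b (ψ : ((K × Fin h) × Fin 2) ↔ B₃.Vertex) → K ↔ Fin k →
    (∀ k j → col (to ψ ((k , j) , 0F)) (to ψ ((k , j) , 1F)) ≡ a) →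
    (∀ k i j → Succ h i j → col (to ψ ((k , i) , 1F)) (to ψ ((k , j) , 0F)) ≡ b) →
    (∀ c → c ≢ just removed → class c ≡ φ → (c ≡ a) ⊎ (c ≡ b)) →
    a ≢ just removed → b ≢ just removed → class a ≡ φ → class b ≡ φ →
    IsCycleFactor (h * 2) (factor φ)
  classFactor {K} {h} φ a b ψ κ even odd classify a≢ b≢ class-a class-b =
    Cycles.isCycleFactor {K} {h} a b ψ even odd vertices κ (factor φ)
      (λ { x y (x≢y , c≢ , cl) → x≢y , classify (colᵥ x y) c≢ cl })
      (λ { x y x≢y (inj₁ e) → x≢y , (λ f → a≢ (trans (sym e) f)) , trans (cong class e) class-a
         ; x y x≢y (inj₂ e) → x≢y , (λ f → b≢ (trans (sym e) f)) , trans (cong class e) class-b })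

  hexagonFactor : IsCycleFactor 6 (factor hexagonClass)
  hexagonFactor = classFactor {Fin (suc t) × Fin x} {3} hexagonClass nothing (just (inj₂ (hexagonColour , 0F)))
    -- The pair (q , s) names the hexagon, so the two coordinates s and i trade places.
    (mk↔ₛ′ (λ { (((q , s) , i) , b) → ((q , i) , s) , b }) (λ { (((q , i) , s) , b) → ((q , s) , i) , b })
      (λ _ → refl) (λ _ → refl))
    (↔-sym *↔×)
    (λ { (q , s) i → nothing-col ((q , i) , s) 0F 1F })
    (λ { (q , s) i j e → hexagon-edge q s i j e })
    classify (λ ()) (λ ()) refl refl
    where
    classify : ∀ c → c ≢ just removed → class c ≡ hexagonClass →
      (c ≡ nothing) ⊎ (c ≡ just (inj₂ (hexagonColour , 0F)))
    classify nothing _ _ = inj₁ refl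
    classify (just (inj₁ _)) _ ()
    classify (just (inj₂ (d , c))) c≢ cl
      with cong proj₁ (inj₁-injective cl) | quotient⁻¹ c 0F (cong proj₂ (inj₁-injective cl))
    ... | refl | inj₁ refl = inj₂ refl
    ... | refl | inj₂ refl = contradiction refl c≢

  -- The class consists of the sums 2r and 2r + 1 of d, which alternate under `crossOrient d` with c
  -- = 2r. Being different from the hexagon class keeps out `nothing` and `removed`.
  bipartiteFactor : ∀ d r → inj₁ (d , r) ≢ hexagonClass → IsCycleFactor (x * 2) (factor (inj₁ (d , r)))
  bipartiteFactor d r φ≢ = classFactor {Fin (suc t) × Fin 3} {x} (inj₁ (d , r))
    (just (inj₂ (d , combine r 0F))) (just (inj₂ (d , combine r 1F)))
    (orient (inj₂ (d , combine r 0F))) (↔-sym *↔×)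
    (λ k j → orient-col (inj₂ (d , combine r 0F)) (k , j))
    (λ k i j e → trans (B₃.crossOrient-step d (combine r 0F) k i j e)
      (cong (λ a → just (inj₂ (d , a))) (combine-next r)))
    classify (not-removed 0F) (not-removed 1F) (class-combine d r 0F) (class-combine d r 1F)
    where
    not-removed : ∀ (b : Fin 2) → just (inj₂ (d , combine r b)) ≢ just removed
    not-removed b e = φ≢ (trans (sym (class-combine d r b)) (cong class e))
    classify : ∀ c → c ≢ just removed → class c ≡ inj₁ (d , r) →
      (c ≡ just (inj₂ (d , combine r 0F))) ⊎ (c ≡ just (inj₂ (d , combine r 1F)))
    classify nothing _ cl = contradiction (sym cl) φ≢
    classify (just (inj₁ _)) _ ()
    classify (just (inj₂ (d′ , c))) _ cl
      with cong proj₁ (inj₁-injective cl) | quotient⁻¹ c r (cong proj₂ (inj₁-injective cl))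
    ... | refl | inj₁ refl = inj₁ refl
    ... | refl | inj₂ refl = inj₂ refl

  hamiltonianFactor : ∀ r → IsCycleFactor (x * 2) (factor (inj₂ r))
  hamiltonianFactor r = classFactor {Fin (suc t) × Fin 3} {x} (inj₂ r)
    (just (inj₁ (r , 0F))) (just (inj₁ (r , 1F)))
    (orient (inj₁ (r , 0F))) (↔-sym *↔×)
    (λ k j → orient-col (inj₁ (r , 0F)) (k , j))
    (λ k i j e → B₃.innerOrient-step r k i j e)
    classify (λ ()) (λ ()) refl refl
    where
    classify : ∀ c → c ≢ just removed → class c ≡ inj₂ r →
      (c ≡ just (inj₁ (r , 0F))) ⊎ (c ≡ just (inj₁ (r , 1F)))
    classify nothing _ ()
    classify (just (inj₂ _)) _ ()
    classify (just (inj₁ (.r , 0F))) _ refl = inj₁ refl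
    classify (just (inj₁ (.r , 1F))) _ refl = inj₂ refl

  otherFactor : ∀ φ → φ ≢ hexagonClass → IsCycleFactor (x * 2) (factor φ)
  otherFactor (inj₁ (d , r)) φ≢ = bipartiteFactor d r φ≢
  otherFactor (inj₂ r)       _  = hamiltonianFactor r

  -- The removed 1-factor

  private
    -- In these coordinates the edges of colour `removed` join (k , 0) to (k , 1), so flipping the
    -- bit gives the matching.
    ρ : Fin v ↔ B₃.Vertex
    ρ = ↔-trans vertices (↔-sym (orient removed))

    swap : B₃.Vertex → B₃.Vertex
    swap (k , b) = k , opposite b

    mate : Fin v → Fin v
    mate = from ρ ∘ swap ∘ to ρ

    swap-≢ : ∀ p → swap p ≢ p
    swap-≢ (k , 0F) ()
    swap-≢ (k , 1F) ()

    mate-≢ : ∀ a → mate a ≢ a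
    mate-≢ a e = swap-≢ (to ρ a) (trans (sym (strictlyInverseˡ ρ (swap (to ρ a)))) (cong (to ρ) e))

    orient-swap : ∀ p → col (to (orient removed) p) (to (orient removed) (swap p)) ≡ just removed
    orient-swap (k , 0F) = orient-col removed k
    orient-swap (k , 1F) = trans
      (col-sym (to (orient removed) (k , 1F)) (to (orient removed) (k , 0F))) (orient-col removed k)

    col-mate : ∀ a → colᵥ a (mate a) ≡ just removed
    col-mate a = trans
      (cong₂ col (sym (strictlyInverseˡ (orient removed) (to vertices a)))
                 (strictlyInverseˡ vertices (to (orient removed) (swap (to ρ a)))))
      (orient-swap (to ρ a))

    mate-involutive : ∀ a → mate (mate a) ≡ a
    mate-involutive a = begin
      from ρ (swap (to ρ (mate a)))   ≡⟨ cong (from ρ ∘ swap) (strictlyInverseˡ ρ (swap (to ρ a))) ⟩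
      from ρ (swap (swap (to ρ a)))   ≡⟨ cong (λ b → from ρ (proj₁ (to ρ a) , b)) (opposite-involutive (proj₂ (to ρ a))) ⟩
      from ρ (to ρ a)                 ≡⟨ strictlyInverseʳ ρ a ⟩
      a                               ∎
      where open ≡-Reasoning

    removed⇒mate : ∀ a b → a ≢ b → colᵥ a b ≡ just removed → b ≡ mate a
    removed⇒mate a b a≢b e = to-injective vertices
      (col-proper (to vertices a) (to vertices b) (to vertices (mate a))
        (λ f → a≢b (sym (to-injective vertices f)))
        (λ f → mate-≢ a (to-injective vertices f))
        (trans e (sym (col-mate a))))

  hwp : HWP v 6 (x * 2) 1 (pred classes)
  hwp = record
    { F      = record { mate = mate ; involut = mate-involutive ; nofix = mate-≢ }
    ; factor = λ i → factor (to index i)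
    -- `index` sends 0 to `hexagonClass` by computation: the inner colours of `B₂` come first, and
    -- (0 , 0) is the first of them.
    ; isM    = λ { zero _ → hexagonFactor ; (suc _) (s≤s ()) }
    ; isN    = λ { zero () ; (suc i) _ → otherFactor (to index (suc i)) (λ e → suc≢0 (to-injective index {suc i} {zero} e)) }
    ; avoidF = λ { i a b (_ , c≢ , _) refl → c≢ (col-mate a) }
    ; cover  = λ a b a≢b b≢mate → from index (class (colᵥ a b)) ,
        a≢b , (λ e → b≢mate (removed⇒mate a b a≢b e)) , sym (strictlyInverseˡ index (class (colᵥ a b)))
    ; unique = λ { i j a b (_ , _ , p) (_ , _ , q) → to-injective index (trans (sym p) q) }
    }
    where
    suc≢0 : ∀ {n} {i : Fin n} → suc i ≢ zero
    suc≢0 ()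

-- Counting the factors and reducing to even x

even-solution : ∀ y t → let x = suc y * 2 in
  HWP (6 * x * suc t) 6 (2 * x) 1 (3 * x * suc t ∸ 2)
even-solution y t =
  subst (λ v → HWP v 6 (2 * x) 1 (3 * x * suc t ∸ 2)) v-eq
    (subst₂ (λ N β → HWP v 6 N 1 β) (*-comm x 2) (cong (_∸ 2) β-eq) hwp)
  where
  open Solution y t
  open +-*-Solver
  v-eq : v ≡ 6 * x * suc t
  v-eq = solve 2 (λ x t → t :* con 3 :* x :* con 2 := con 6 :* x :* t) refl x (suc t)
  -- There are (6t + 4)(y + 1) + 2y + 1 = 3x(t + 1) - 1 classes, one of them the hexagon class.
  β-eq : 2 + pred classes ≡ 3 * x * suc t
  β-eq = solve 2 (λ y t →
      con 1 :+ ((con 4 :+ t :* con 2 :* con 3) :* (con 1 :+ y) :+ (con 1 :+ y :* con 2))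
        := con 3 :* ((con 1 :+ y) :* con 2) :* (con 1 :+ t)) refl y t

theorem7 : (x t : ℕ) → 1 ≤ x → 1 ≤ t →
    (x % 6 ≡ 2 ⊎ x % 6 ≡ 4) →
    HWP (6 * x * t) 6 (2 * x) 1 (3 * x * t ∸ 2)
theorem7 x (suc t) _ _ residue = subst (λ x → HWP (6 * x * suc t) 6 (2 * x) 1 (3 * x * suc t ∸ 2))
  (sym (proj₂ (half residue))) (even-solution (proj₁ (half residue)) t)
  where
  open +-*-Solver
  -- With q = x / 6, the witness y = x / 2 - 1 is 3q for x = 6q + 2 and 3q + 1 for x = 6q + 4.
  half : x % 6 ≡ 2 ⊎ x % 6 ≡ 4 → ∃ λ y → x ≡ suc y * 2
  half (inj₁ e) = x / 6 * 3 , trans (m≡m%n+[m/n]*n x 6) (trans (cong (_+ x / 6 * 6) e)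
    (solve 1 (λ q → con 2 :+ q :* con 6 := (con 1 :+ q :* con 3) :* con 2) refl (x / 6)))
  half (inj₂ e) = suc (x / 6 * 3) , trans (m≡m%n+[m/n]*n x 6) (trans (cong (_+ x / 6 * 6) e)
    (solve 1 (λ q → con 4 :+ q :* con 6 := (con 2 :+ q :* con 3) :* con 2) refl (x / 6)))
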